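{- For all $k,N,M\in\mathbb{N}$ with $N\le M$, $$G_{k,N,M}(x)=D_{k,N}(x)\prod_{j=N}^{M-1}\frac{1+x^{(k+1)(N+j)}}{1-x^{(k+1)j+1}}$$ as formal power series in $x$. Consequently, the following two assertions are equivalent: (1) for all $a,b,m,N,M\in\mathbb{N}$ with $b\mid a$, $a+b=m$ and $N\le M$, one has $g_{a,b,m}(N,M;q)\in\mathbb{N}_0[[q]]$; (2) for all $k,N\in\mathbb{N}$, one has $D_{k,N}(x)\in\mathbb{N}_0[[x]]$.
   Context: $\mathbb{N}$ is the set of positive integers and $\mathbb{N}_0=\mathbb{N}\cup\{0\}$. Notation: $(z;q)_n=\prod_{i=0}^{n-1}(1-zq^i)$. For $a,b,m,N,M\in\mathbb{N}$, $$g_{a,b,m}(N,M;q):=\frac{(-q^m;q^m)_{N+M-1}}{(-q^a;q^m)_N\,(q^b;q^m)_M}.$$ For $k,N,M\in\mathbb{N}$, $$G_{k,N,M}(x):=\frac{(-x^{k+1};x^{k+1})_{N+M-1}}{(-x^{k};x^{k+1})_N\,(x;x^{k+1})_M},\qquad D_{k,N}(x):=G_{k,N,N}(x).$$ (So $G_{k,N,M}(q^b)=g_{a,b,a+b}(N,M;q)$ when $a=kb$.) All quotients are expanded as formal power series; $\mathbb{N}_0[[x]]$ is the set of power series with non-negative integer coefficients. Empty products equal $1$. -}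

module Defs where

open import Algebra.Bundles.Raw using (RawRing)
import Algebra.Definitions.RawSemiring as RawSemiringDefinitions
open import Algebra.Properties.CommutativeMonoid.Sum using (sum)
open import Data.Fin.Base using (Fin; zero; suc; toℕ)
open import Data.Integer.Base as ℤ using (ℤ; 0ℤ; 1ℤ)
import Data.Integer.Properties as ℤ
open import Data.Nat.Base as ℕ using (ℕ; zero; suc; NonZero)
import Data.Nat.Properties as ℕ
open import Level using (0ℓ)
open import Relation.Binary.PropositionalEquality using (_≡_; refl; sym; trans; cong; cong₂; subst)

infix  4 _≈_
infixl 6 _+_ _-_
infixl 7 _*_
infixl 7 _/_⟨_⟩
infix  8 -_

-- A formal power series over ℤ is its sequence of coefficients.

PowerSeries : Set
PowerSeries = ℕ → ℤ

_≈_ : PowerSeries → PowerSeries → Set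
f ≈ g = ∀ n → f n ≡ g n

0# 1# X : PowerSeries
0# _       = 0ℤ
1# zero    = 1ℤ
1# (suc _) = 0ℤ
X 1        = 1ℤ
X _        = 0ℤ

∑ : ∀ {n} → (Fin n → ℤ) → ℤ
∑ = sum ℤ.+-0-commutativeMonoid

-_ : PowerSeries → PowerSeries
(- f) n = ℤ.- f n

_+_ _-_ _*_ : PowerSeries → PowerSeries → PowerSeries
(f + g) n = f n ℤ.+ g n
f - g     = f + (- g)
(f * g) n = ∑ {suc n} λ i → f (toℕ i) ℤ.* g (n ℕ.∸ toℕ i)

rawRing : RawRing 0ℓ 0ℓ
rawRing = record
  { Carrier = PowerSeries
  ; _≈_     = _≈_
  ; _+_     = _+_
  ; _*_     = _*_
  ; -_      = -_
  ; 0#      = 0#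
  ; 1#      = 1#
  }

open RawSemiringDefinitions (RawRing.rawSemiring rawRing) public using (_^_; product)

-- 1 / g = ∑ₖ (1 - g)ᵏ.  When g has constant term 1, the terms with k > n
-- do not contribute to the coefficient of xⁿ, so the sum stops at k = n.

_/_⟨_⟩ : (f g : PowerSeries) → .(g 0 ≡ 1ℤ) → PowerSeries
f / g ⟨ _ ⟩ = f * λ n → ∑ {suc n} λ k → ((1# - g) ^ toℕ k) n

-- Membership in ℕ₀[[x]].

NonNegative : PowerSeries → Set
NonNegative f = ∀ n → 0ℤ ℤ.≤ f n

-- ∏[ N , M ⟩ t is the product of t j over N ≤ j < M.

∏[_,_⟩ : ℕ → ℕ → (ℕ → PowerSeries) → PowerSeries
∏[ N , M ⟩ t = product {M ℕ.∸ N} λ i → t (N ℕ.+ toℕ i)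

-- (z; q)ₙ

qPochhammer : PowerSeries → PowerSeries → ℕ → PowerSeries
qPochhammer z q n = ∏[ 0 , n ⟩ λ i → 1# - z * q ^ i

*-constantTerm : ∀ f g → (f * g) 0 ≡ f 0 ℤ.* g 0
*-constantTerm f g = ℤ.+-identityʳ (f 0 ℤ.* g 0)

*-constantTerm-1 : ∀ f g → f 0 ≡ 1ℤ → g 0 ≡ 1ℤ → (f * g) 0 ≡ 1ℤ
*-constantTerm-1 f g f₀≡1 g₀≡1 = trans (*-constantTerm f g) (cong₂ ℤ._*_ f₀≡1 g₀≡1)

^-constantTerm : ∀ n → .{{NonZero n}} → (X ^ n) 0 ≡ 0ℤ
^-constantTerm (suc n) = *-constantTerm X (X ^ n)

1-f-constantTerm : ∀ f → f 0 ≡ 0ℤ → (1# - f) 0 ≡ 1ℤ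
1-f-constantTerm f f₀≡0 = cong (λ c → 1ℤ ℤ.- c) f₀≡0

product-constantTerm : ∀ {n} (t : Fin n → PowerSeries) → (∀ i → t i 0 ≡ 1ℤ) → product t 0 ≡ 1ℤ
product-constantTerm {zero}  t t₀≡1 = refl
product-constantTerm {suc n} t t₀≡1 =
  *-constantTerm-1 (t zero) (product λ i → t (suc i)) (t₀≡1 zero)
    (product-constantTerm (λ i → t (suc i)) λ i → t₀≡1 (suc i))

qPochhammer-constantTerm : ∀ z q n → z 0 ≡ 0ℤ → qPochhammer z q n 0 ≡ 1ℤ
qPochhammer-constantTerm z q n z₀≡0 = product-constantTerm {n} (λ i → 1# - z * q ^ toℕ i) λ i →
  1-f-constantTerm (z * q ^ toℕ i)
    (trans (*-constantTerm z (q ^ toℕ i)) (cong (ℤ._* (q ^ toℕ i) 0) z₀≡0))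

denominator-constantTerm : ∀ z w q N M → z 0 ≡ 0ℤ → w 0 ≡ 0ℤ →
  (qPochhammer (- z) q N * qPochhammer w q M) 0 ≡ 1ℤ
denominator-constantTerm z w q N M z₀≡0 w₀≡0 =
  *-constantTerm-1 (qPochhammer (- z) q N) (qPochhammer w q M)
    (qPochhammer-constantTerm (- z) q N (cong ℤ.-_ z₀≡0))
    (qPochhammer-constantTerm w q M w₀≡0)

1-X^[n+1]-constantTerm : ∀ n → (1# - X ^ (n ℕ.+ 1)) 0 ≡ 1ℤ
1-X^[n+1]-constantTerm n = 1-f-constantTerm (X ^ (n ℕ.+ 1))
  (subst (λ e → (X ^ e) 0 ≡ 0ℤ) (ℕ.+-comm 1 n) (^-constantTerm (suc n)))

g : (a b m N M : ℕ) → .{{NonZero a}} → .{{NonZero b}} → PowerSeries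
g a b m N M =
  qPochhammer (- (X ^ m)) (X ^ m) (N ℕ.+ M ℕ.∸ 1)
    / qPochhammer (- (X ^ a)) (X ^ m) N * qPochhammer (X ^ b) (X ^ m) M
    ⟨ denominator-constantTerm (X ^ a) (X ^ b) (X ^ m) N M (^-constantTerm a) (^-constantTerm b) ⟩

G : (k N M : ℕ) → .{{NonZero k}} → PowerSeries
G k N M =
  qPochhammer (- (X ^ (k ℕ.+ 1))) (X ^ (k ℕ.+ 1)) (N ℕ.+ M ℕ.∸ 1)
    / qPochhammer (- (X ^ k)) (X ^ (k ℕ.+ 1)) N * qPochhammer X (X ^ (k ℕ.+ 1)) M
    ⟨ denominator-constantTerm (X ^ k) X (X ^ (k ℕ.+ 1)) N M (^-constantTerm k) refl ⟩

D : (k N : ℕ) → .{{NonZero k}} → PowerSeries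
D k N = G k N N

{-# OPTIONS --safe #-}
module Submission where

-- Passing from D to G multiplies the numerator by the factors 1 + x^((k+1)(N+j)) and the
-- denominator by the factors 1 - x^((k+1)j+1), N ≤ j < M; each of their quotients is
-- (1 + x^e) ∑ᵢ xⁱᵈ, which has non-negative coefficients.  Finally, when a = k b, the series
-- g a b (a + b) N M arises from G k N M by the ring endomorphism x ↦ x^b, which only
-- spreads out the coefficients.

open import Defs
open import Algebra.Bundles using (CommutativeRing)
open import Algebra.Structures using (IsCommutativeRing)
import Algebra.Construct.Pointwise as Pointwise
import Algebra.Consequences.Setoid as Consequences
import Algebra.Properties.CommutativeMonoid.Sum as CommutativeMonoidSum
import Algebra.Properties.CommutativeSemigroup as CommutativeSemigroupProperties
import Algebra.Properties.CommutativeSemiring.Exp as Exp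
import Algebra.Properties.Ring as RingProperties
import Algebra.Properties.Semiring.Sum as SemiringSum
open import Data.Fin.Base using (Fin; zero; suc; toℕ)
open import Data.Integer.Base as ℤ using (ℤ; 0ℤ; 1ℤ)
import Data.Integer.Properties as ℤ
open import Data.Nat.Base as ℕ using (ℕ; zero; suc; NonZero; s≤s)
open import Data.Nat.Divisibility.Core using (_∣_; divides)
import Data.Nat.Properties as ℕ
open import Data.Product.Base using (_×_; _,_)
open import Function.Base using (_∘_)
open import Function.Bundles using (_⇔_; mk⇔)
open import Level using (0ℓ)
open import Relation.Nullary.Decidable.Core using (recompute)
open import Relation.Binary.Bundles using (Setoid)
open import Relation.Binary.PropositionalEquality using (_≡_; refl; sym; trans; cong; cong₂; subst; module ≡-Reasoning)
import Relation.Binary.Reasoning.Setoid as SetoidReasoning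

-- The commutative ring of formal power series.

module ℤ-Sum = SemiringSum (CommutativeRing.semiring ℤ.+-*-commutativeRing)

infixr 7 _∙_

tail : PowerSeries → PowerSeries
tail f n = f (suc n)

-- Scaling is what makes products recursive: the tail of `f * g` is definitionally
-- `f 0 ∙ tail g + tail f * g`.
_∙_ : ℤ → PowerSeries → PowerSeries
(c ∙ f) n = c ℤ.* f n

setoid : Setoid 0ℓ 0ℓ
setoid = record
  { Carrier       = PowerSeries
  ; _≈_           = _≈_
  ; isEquivalence = Pointwise.isEquivalence ℕ (Setoid.isEquivalence ℤ.≡-setoid)
  }

-- (f * g) (suc n) reduces to f 0 ℤ.* g (suc n) ℤ.+ (tail f * g) n, which is
-- what the inductions on the coefficient index below rely on.

-- The convolution at `n` reads the right factor only up to index `n`. Asking for agreement only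
-- there allows partial geometric sums of different lengths to be exchanged under a product.
*-cong-≤ : ∀ {f g u v : PowerSeries} n → f ≈ g → (∀ i → i ℕ.≤ n → u i ≡ v i) → (f * u) n ≡ (g * v) n
*-cong-≤ n f≈g u≡v = ℤ-Sum.sum-cong-≗ {suc n} λ i →
  cong₂ ℤ._*_ (f≈g (toℕ i)) (u≡v (n ℕ.∸ toℕ i) (ℕ.m∸n≤m n (toℕ i)))

*-cong : ∀ {f g u v : PowerSeries} → f ≈ g → u ≈ v → f * u ≈ g * v
*-cong f≈g u≈v n = *-cong-≤ n f≈g λ i _ → u≈v i

*-distribʳ-+ : ∀ f g h → (g + h) * f ≈ g * f + h * f
*-distribʳ-+ f g h n = trans
  (ℤ-Sum.sum-cong-≗ {suc n} λ i → ℤ.*-distribʳ-+ (f (n ℕ.∸ toℕ i)) (g (toℕ i)) (h (toℕ i)))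
  (ℤ-Sum.∑-distrib-+ {suc n} (λ i → g (toℕ i) ℤ.* f (n ℕ.∸ toℕ i)) λ i → h (toℕ i) ℤ.* f (n ℕ.∸ toℕ i))

∙-*-assoc : ∀ c f g → (c ∙ f) * g ≈ c ∙ (f * g)
∙-*-assoc c f g n = trans
  (ℤ-Sum.sum-cong-≗ {suc n} λ i → ℤ.*-assoc c (f (toℕ i)) (g (n ℕ.∸ toℕ i)))
  (sym (ℤ-Sum.*-distribˡ-sum {suc n} c λ i → f (toℕ i) ℤ.* g (n ℕ.∸ toℕ i)))

*-zeroˡ : ∀ f → 0# * f ≈ 0#
*-zeroˡ f zero    = refl
*-zeroˡ f (suc n) = trans (ℤ.+-identityˡ _) (*-zeroˡ f n)

*-identityˡ : ∀ f → 1# * f ≈ f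
*-identityˡ f zero    = trans (ℤ.+-identityʳ _) (ℤ.*-identityˡ (f 0))
*-identityˡ f (suc n) = trans
  (cong₂ ℤ._+_ (ℤ.*-identityˡ (f (suc n))) (*-zeroˡ f n))
  (ℤ.+-identityʳ (f (suc n)))

-- The mirror image of the definitional recursion: the last summand of the convolution is split off
-- instead of the first. Comparing the two recursions gives commutativity.
*-tailʳ : ∀ f g n → (f * g) (suc n) ≡ (f * tail g) n ℤ.+ f (suc n) ℤ.* g 0
*-tailʳ f g zero    = cong₂ ℤ._+_ (sym (ℤ.+-identityʳ (f 0 ℤ.* g 1))) (ℤ.+-identityʳ (f 1 ℤ.* g 0))
*-tailʳ f g (suc n) = trans
  (cong (ℤ._+_ (f 0 ℤ.* g (suc (suc n)))) (*-tailʳ (tail f) g n))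
  (sym (ℤ.+-assoc (f 0 ℤ.* g (suc (suc n))) ((tail f * tail g) n) (f (suc (suc n)) ℤ.* g 0)))

*-comm : ∀ f g → f * g ≈ g * f
*-comm f g zero    = cong (ℤ._+ 0ℤ) (ℤ.*-comm (f 0) (g 0))
*-comm f g (suc n) = begin
  f 0 ℤ.* g (suc n) ℤ.+ (tail f * g) n  ≡⟨ cong₂ ℤ._+_ (ℤ.*-comm (f 0) (g (suc n))) (*-comm (tail f) g n) ⟩
  g (suc n) ℤ.* f 0 ℤ.+ (g * tail f) n  ≡⟨ ℤ.+-comm (g (suc n) ℤ.* f 0) ((g * tail f) n) ⟩
  (g * tail f) n ℤ.+ g (suc n) ℤ.* f 0  ≡⟨ *-tailʳ g f n ⟨
  (g * f) (suc n)                       ∎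
  where open ≡-Reasoning

*-assoc : ∀ f g h → (f * g) * h ≈ f * (g * h)
*-assoc f g h zero    = begin
  ((f * g) * h) 0            ≡⟨ *-constantTerm (f * g) h ⟩
  (f * g) 0 ℤ.* h 0          ≡⟨ cong (ℤ._* h 0) (*-constantTerm f g) ⟩
  (f 0 ℤ.* g 0) ℤ.* h 0      ≡⟨ ℤ.*-assoc (f 0) (g 0) (h 0) ⟩
  f 0 ℤ.* (g 0 ℤ.* h 0)      ≡⟨ cong (f 0 ℤ.*_) (*-constantTerm g h) ⟨
  f 0 ℤ.* (g * h) 0          ≡⟨ *-constantTerm f (g * h) ⟨
  (f * (g * h)) 0            ∎
  where open ≡-Reasoning
*-assoc f g h (suc n) = begin
  -- The tail of `f * g` has unfolded into a scaled part and a product with `tail f`; linearity in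
  -- the left factor separates them, and the induction hypothesis applies to `tail f`.
  (f * g) 0 ℤ.* h (suc n) ℤ.+ ((f 0 ∙ tail g + tail f * g) * h) n
    ≡⟨ cong₂ ℤ._+_ (cong (ℤ._* h (suc n)) (*-constantTerm f g)) (*-distribʳ-+ h (f 0 ∙ tail g) (tail f * g) n) ⟩
  f 0 ℤ.* g 0 ℤ.* h (suc n) ℤ.+ (((f 0 ∙ tail g) * h) n ℤ.+ (tail f * g * h) n)
    ≡⟨ cong₂ ℤ._+_ (ℤ.*-assoc (f 0) (g 0) (h (suc n))) (cong₂ ℤ._+_ (∙-*-assoc (f 0) (tail g) h n) (*-assoc (tail f) g h n)) ⟩
  f 0 ℤ.* (g 0 ℤ.* h (suc n)) ℤ.+ (f 0 ℤ.* (tail g * h) n ℤ.+ (tail f * (g * h)) n)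
    ≡⟨ ℤ.+-assoc (f 0 ℤ.* (g 0 ℤ.* h (suc n))) (f 0 ℤ.* (tail g * h) n) ((tail f * (g * h)) n) ⟨
  f 0 ℤ.* (g 0 ℤ.* h (suc n)) ℤ.+ f 0 ℤ.* (tail g * h) n ℤ.+ (tail f * (g * h)) n
    ≡⟨ cong (ℤ._+ (tail f * (g * h)) n) (ℤ.*-distribˡ-+ (f 0) (g 0 ℤ.* h (suc n)) ((tail g * h) n)) ⟨
  (f * (g * h)) (suc n) ∎
  where open ≡-Reasoning

isCommutativeRing : IsCommutativeRing _≈_ _+_ _*_ -_ 0# 1#
isCommutativeRing = record
  { isRing = record
    { +-isAbelianGroup = Pointwise.isAbelianGroup ℕ ℤ.+-0-isAbelianGroup
    ; *-cong           = *-cong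
    ; *-assoc          = *-assoc
    ; *-identity       = comm∧idˡ⇒id *-comm *-identityˡ
    ; distrib          = comm∧distrʳ⇒distr (λ f≈g h≈k n → cong₂ ℤ._+_ (f≈g n) (h≈k n)) *-comm *-distribʳ-+
    }
  ; *-comm = *-comm
  }
  where open Consequences setoid

commutativeRing : CommutativeRing 0ℓ 0ℓ
commutativeRing = record { isCommutativeRing = isCommutativeRing }

module R = CommutativeRing commutativeRing
module RP = RingProperties R.ring
module RE = Exp R.commutativeSemiring
module Product = CommutativeMonoidSum R.*-commutativeMonoid

-- Quotients

-- The partial sum of the geometric series with `K` terms. The length is kept separate from the
-- coefficient index, although the definition of the quotient ties the two together.
geometric : PowerSeries → ℕ → PowerSeries
geometric f K n = ∑ {K} λ k → (f ^ toℕ k) n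

*-distribˡ-∑ : ∀ {K} f (t : Fin K → PowerSeries) → f * (λ n → ∑ λ k → t k n) ≈ λ n → ∑ λ k → (f * t k) n
*-distribˡ-∑ {zero}  f t n = R.zeroʳ f n
*-distribˡ-∑ {suc K} f t n = trans
  (R.distribˡ f (t zero) (λ n → ∑ λ k → t (suc k) n) n)
  (cong (ℤ._+_ ((f * t zero) n)) (*-distribˡ-∑ f (t ∘ suc) n))

geometric-suc : ∀ f K → geometric f (suc K) ≈ 1# + f * geometric f K
geometric-suc f K n = cong (ℤ._+_ (1# n)) (sym (*-distribˡ-∑ {K} f (λ k → f ^ toℕ k) n))

-- A factor without constant term delays the other one: the coefficient at `suc n` reads `g` only up
-- to index `n`.
*-tail : ∀ f g n → f 0 ≡ 0ℤ → (f * g) (suc n) ≡ (tail f * g) n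
*-tail f g n f₀≡0 = trans
  (cong (λ c → c ℤ.* g (suc n) ℤ.+ (tail f * g) n) f₀≡0)
  (ℤ.+-identityˡ ((tail f * g) n))

-- Powers `f ^ k` with `k > n` have no term in degree `n`. Instead of bounding orders, the proof
-- unrolls both sums once; the remaining factor `f` lowers the degree to be compared, along with
-- both lengths.
geometric-stable : ∀ f → f 0 ≡ 0ℤ → ∀ K L n → n ℕ.< K → n ℕ.< L → geometric f K n ≡ geometric f L n
geometric-stable f f₀≡0 (suc K) (suc L) n (s≤s n≤K) (s≤s n≤L) = begin
  geometric f (suc K) n               ≡⟨ geometric-suc f K n ⟩
  1# n ℤ.+ (f * geometric f K) n      ≡⟨ cong (ℤ._+_ (1# n)) (lemma n n≤K n≤L) ⟩
  1# n ℤ.+ (f * geometric f L) n      ≡⟨ geometric-suc f L n ⟨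
  geometric f (suc L) n               ∎
  where
  open ≡-Reasoning
  lemma : ∀ n → n ℕ.≤ K → n ℕ.≤ L → (f * geometric f K) n ≡ (f * geometric f L) n
  lemma zero    _   _   = cong (λ c → c ℤ.+ 0ℤ)
    (trans (cong (ℤ._* geometric f K 0) f₀≡0) (sym (cong (ℤ._* geometric f L 0) f₀≡0)))
  lemma (suc n) n<K n<L = begin
    (f * geometric f K) (suc n)   ≡⟨ *-tail f (geometric f K) n f₀≡0 ⟩
    (tail f * geometric f K) n    ≡⟨ *-cong-≤ {tail f} n (λ _ → refl) (λ i i≤n → geometric-stable f f₀≡0 K L i
                                       (ℕ.≤-<-trans i≤n n<K) (ℕ.≤-<-trans i≤n n<L)) ⟩
    (tail f * geometric f L) n    ≡⟨ *-tail f (geometric f L) n f₀≡0 ⟨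
    (f * geometric f L) (suc n)   ∎

-- Definitionally the factor by which the quotient multiplies its numerator. It is a diagonal: the
-- number of terms grows with the coefficient index.
reciprocal : PowerSeries → PowerSeries
reciprocal g n = geometric (1# - g) (suc n) n

1-[1-f]≈f : ∀ f → 1# - (1# - f) ≈ f
1-[1-f]≈f f = begin
  1# + - (1# + - f)      ≈⟨ R.+-congˡ {1#} (λ n → sym (RP.-‿+-comm 1# (- f) n)) ⟩
  1# + (- 1# + - - f)    ≈⟨ R.+-assoc 1# (- 1#) (- - f) ⟨
  (1# - 1#) + - - f      ≈⟨ R.+-cong (R.-‿inverseʳ 1#) (RP.-‿involutive f) ⟩
  0# + f                 ≈⟨ R.+-identityˡ f ⟩
  f                      ∎
  where open SetoidReasoning R.setoid

-- The recursion of the partial sums, read along the diagonal. Solved for the constant `1#`, it says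
-- that `g * reciprocal g` is `1#`.
reciprocal-fixpoint : ∀ g → g 0 ≡ 1ℤ → reciprocal g ≈ 1# + (1# - g) * reciprocal g
reciprocal-fixpoint g g₀≡1 n = trans (geometric-suc h n n) (cong (ℤ._+_ (1# n)) (lemma n))
  where
  h : PowerSeries
  h = 1# - g
  h₀≡0 : h 0 ≡ 0ℤ
  h₀≡0 = cong (ℤ._-_ 1ℤ) g₀≡1
  open ≡-Reasoning
  -- On the left the length is fixed at `n`; on the right it varies with the coefficient read.
  -- Stability reconciles the two.
  lemma : ∀ n → (h * geometric h n) n ≡ (h * reciprocal g) n
  -- Here the sums do differ, `0ℤ` against `1ℤ`, but both are multiplied by `h 0`, which vanishes.
  lemma zero    = cong (ℤ._+ 0ℤ) (trans (cong (ℤ._* 0ℤ) h₀≡0) (cong (ℤ._* 1ℤ) (sym h₀≡0)))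
  lemma (suc n) = begin
    (h * geometric h (suc n)) (suc n)  ≡⟨ *-tail h (geometric h (suc n)) n h₀≡0 ⟩
    (tail h * geometric h (suc n)) n   ≡⟨ *-cong-≤ {tail h} n (λ _ → refl) (λ i i≤n →
                                            geometric-stable h h₀≡0 (suc n) (suc i) i (s≤s i≤n) ℕ.≤-refl) ⟩
    (tail h * reciprocal g) n          ≡⟨ *-tail h (reciprocal g) n h₀≡0 ⟨
    (h * reciprocal g) (suc n)         ∎

*-reciprocal : ∀ g → g 0 ≡ 1ℤ → g * reciprocal g ≈ 1#
*-reciprocal g g₀≡1 = begin
  g * r                      ≈⟨ R.*-congʳ {r} (1-[1-f]≈f g) ⟨
  (1# - h) * r               ≈⟨ R.distribʳ r 1# (- h) ⟩
  1# * r + - h * r           ≈⟨ R.+-cong {1# * r} {r} (R.*-identityˡ r) (λ n → sym (RP.-‿distribˡ-* h r n)) ⟩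
  r - h * r                  ≈⟨ R.+-congʳ { - (h * r)} (reciprocal-fixpoint g g₀≡1) ⟩
  1# + h * r - h * r         ≈⟨ R.+-assoc 1# (h * r) (- (h * r)) ⟩
  1# + (h * r - h * r)       ≈⟨ R.+-congˡ {1#} (R.-‿inverseʳ (h * r)) ⟩
  1# + 0#                    ≈⟨ R.+-identityʳ 1# ⟩
  1#                         ∎
  where
  h r : PowerSeries
  h = 1# - g
  r = reciprocal g
  open SetoidReasoning R.setoid

/-* : ∀ f g .(g₀≡1 : g 0 ≡ 1ℤ) → f / g ⟨ g₀≡1 ⟩ * g ≈ f
/-* f g g₀≡1 = begin
  (f * reciprocal g) * g   ≈⟨ R.*-assoc f (reciprocal g) g ⟩
  f * (reciprocal g * g)   ≈⟨ R.*-congˡ {f} (R.*-comm (reciprocal g) g) ⟩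
  -- Equality of integers is decidable, so the irrelevant proof about the constant term can be
  -- recovered.
  f * (g * reciprocal g)   ≈⟨ R.*-congˡ {f} (*-reciprocal g (recompute (g 0 ℤ.≟ 1ℤ) g₀≡1)) ⟩
  f * 1#                   ≈⟨ R.*-identityʳ f ⟩
  f                        ∎
  where open SetoidReasoning R.setoid

-- Multiplying by the reciprocal cancels `g`. Identities between quotients thereby reduce to
-- identities between products.
/-unique : ∀ f g h .(g₀≡1 : g 0 ≡ 1ℤ) → h * g ≈ f → h ≈ f / g ⟨ g₀≡1 ⟩
/-unique f g h g₀≡1 h*g≈f = begin
  h                        ≈⟨ R.*-identityʳ h ⟨
  h * 1#                   ≈⟨ R.*-congˡ {h} (*-reciprocal g (recompute (g 0 ℤ.≟ 1ℤ) g₀≡1)) ⟨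
  h * (g * reciprocal g)   ≈⟨ R.*-assoc h g (reciprocal g) ⟨
  (h * g) * reciprocal g   ≈⟨ R.*-congʳ {reciprocal g} h*g≈f ⟩
  f * reciprocal g         ∎
  where open SetoidReasoning R.setoid

/-cong : ∀ f₁ f₂ g₁ g₂ .(p : g₁ 0 ≡ 1ℤ) .(q : g₂ 0 ≡ 1ℤ) → f₁ ≈ f₂ → g₁ ≈ g₂ →
  f₁ / g₁ ⟨ p ⟩ ≈ f₂ / g₂ ⟨ q ⟩
/-cong f₁ f₂ g₁ g₂ p q f₁≈f₂ g₁≈g₂ = /-unique f₂ g₂ (f₁ / g₁ ⟨ p ⟩) q (begin
  f₁ / g₁ ⟨ p ⟩ * g₂   ≈⟨ R.*-congˡ {f₁ / g₁ ⟨ p ⟩} g₁≈g₂ ⟨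
  f₁ / g₁ ⟨ p ⟩ * g₁   ≈⟨ /-* f₁ g₁ p ⟩
  f₁                   ≈⟨ f₁≈f₂ ⟩
  f₂                   ∎)
  where open SetoidReasoning R.setoid

-- Products

product-++ : ∀ m n (t : ℕ → PowerSeries) →
  product {m ℕ.+ n} (λ i → t (toℕ i)) ≈ product {m} (λ i → t (toℕ i)) * product {n} (λ i → t (m ℕ.+ toℕ i))
product-++ zero    n t = λ k → sym (R.*-identityˡ (product {n} λ i → t (toℕ i)) k)
product-++ (suc m) n t = begin
  t 0 * product {m ℕ.+ n} (λ i → t (suc (toℕ i)))
    ≈⟨ R.*-congˡ {t 0} (product-++ m n (t ∘ suc)) ⟩
  t 0 * (product {m} (λ i → t (suc (toℕ i))) * product {n} (λ i → t (suc m ℕ.+ toℕ i)))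
    ≈⟨ R.*-assoc (t 0) (product {m} λ i → t (suc (toℕ i))) (product {n} λ i → t (suc m ℕ.+ toℕ i)) ⟨
  (t 0 * product {m} (λ i → t (suc (toℕ i)))) * product {n} (λ i → t (suc m ℕ.+ toℕ i)) ∎
  where open SetoidReasoning R.setoid

∏-split : ∀ m n t → m ℕ.≤ n → ∏[ 0 , n ⟩ t ≈ ∏[ 0 , m ⟩ t * ∏[ m , n ⟩ t
∏-split m n t m≤n = R.trans
  (R.reflexive (cong (λ l → ∏[ 0 , l ⟩ t) (sym (ℕ.m+[n∸m]≡n m≤n))))
  (product-++ m (n ℕ.∸ m) t)

∏-cong : ∀ m n {s t : ℕ → PowerSeries} → (∀ i → s i ≈ t i) → ∏[ m , n ⟩ s ≈ ∏[ m , n ⟩ t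
∏-cong m n s≈t = Product.sum-cong-≋ {n ℕ.∸ m} λ i → s≈t (m ℕ.+ toℕ i)

∏-shift : ∀ c m n (t : ℕ → PowerSeries) → ∏[ c ℕ.+ m , c ℕ.+ n ⟩ t ≈ ∏[ m , n ⟩ λ i → t (c ℕ.+ i)
∏-shift c m n t = begin
  product {c ℕ.+ n ℕ.∸ (c ℕ.+ m)} (λ i → t (c ℕ.+ m ℕ.+ toℕ i))
    ≡⟨ cong (λ l → product {l} λ i → t (c ℕ.+ m ℕ.+ toℕ i)) (ℕ.[m+n]∸[m+o]≡n∸o c n m) ⟩
  product {n ℕ.∸ m} (λ i → t (c ℕ.+ m ℕ.+ toℕ i))
    ≈⟨ Product.sum-cong-≋ {n ℕ.∸ m} (λ i → R.reflexive (cong t (ℕ.+-assoc c m (toℕ i)))) ⟩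
  product {n ℕ.∸ m} (λ i → t (c ℕ.+ (m ℕ.+ toℕ i))) ∎
  where open SetoidReasoning R.setoid

-- With the denominators cleared, the product of the `t i` never has to be inverted itself.
∏-/ : ∀ m n (s t : ℕ → PowerSeries) .(t₀≡1 : ∀ i → t i 0 ≡ 1ℤ) →
  ∏[ m , n ⟩ (λ i → s i / t i ⟨ t₀≡1 i ⟩) * ∏[ m , n ⟩ t ≈ ∏[ m , n ⟩ s
∏-/ m n s t t₀≡1 = begin
  ∏[ m , n ⟩ (λ i → s i / t i ⟨ t₀≡1 i ⟩) * ∏[ m , n ⟩ t
    ≈⟨ Product.∑-distrib-+ {n ℕ.∸ m} (λ i → s (m ℕ.+ toℕ i) / t (m ℕ.+ toℕ i) ⟨ t₀≡1 (m ℕ.+ toℕ i) ⟩) (λ i → t (m ℕ.+ toℕ i)) ⟨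
  ∏[ m , n ⟩ (λ i → s i / t i ⟨ t₀≡1 i ⟩ * t i)
    ≈⟨ ∏-cong m n (λ i → /-* (s i) (t i) (t₀≡1 i)) ⟩
  ∏[ m , n ⟩ s ∎
  where open SetoidReasoning R.setoid

-- q-Pochhammer symbols and the passage from `D` to `G`.

1-[-f]*g≈1+f*g : ∀ f g → 1# - (- f) * g ≈ 1# + f * g
1-[-f]*g≈1+f*g f g = begin
  1# - (- f) * g      ≈⟨ R.+-congˡ {1#} (R.-‿cong (λ n → sym (RP.-‿distribˡ-* f g n))) ⟩
  1# - (- (f * g))    ≈⟨ R.+-congˡ {1#} (RP.-‿involutive (f * g)) ⟩
  1# + f * g          ∎
  where open SetoidReasoning R.setoid

-- The factor of index `i` is `1# + X ^ (s * suc i)`. The additional indices are `N - 1 + j` with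
-- `N ≤ j < M`, so the two shifts by one cancel and the exponent becomes `s * (N + j)`.
qPochhammer-numerator : ∀ s N M → .{{NonZero N}} → N ℕ.≤ M →
  qPochhammer (- (X ^ s)) (X ^ s) (N ℕ.+ M ℕ.∸ 1)
    ≈ qPochhammer (- (X ^ s)) (X ^ s) (N ℕ.+ N ℕ.∸ 1) * ∏[ N , M ⟩ λ j → 1# + X ^ (s ℕ.* (N ℕ.+ j))
-- With `N` a successor, the truncated subtraction in `N + M ∸ 1` computes to `N-1 + M`.
qPochhammer-numerator s N@(suc N-1) M N≤M = begin
  ∏[ 0 , N-1 ℕ.+ M ⟩ t
    ≈⟨ ∏-split (N-1 ℕ.+ N) (N-1 ℕ.+ M) t (ℕ.+-monoʳ-≤ N-1 N≤M) ⟩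
  ∏[ 0 , N-1 ℕ.+ N ⟩ t * ∏[ N-1 ℕ.+ N , N-1 ℕ.+ M ⟩ t
    ≈⟨ R.*-congˡ {∏[ 0 , N-1 ℕ.+ N ⟩ t} (∏-shift N-1 N M t) ⟩
  ∏[ 0 , N-1 ℕ.+ N ⟩ t * ∏[ N , M ⟩ (λ j → t (N-1 ℕ.+ j))
    ≈⟨ R.*-congˡ {∏[ 0 , N-1 ℕ.+ N ⟩ t} (∏-cong N M λ j → factor (N-1 ℕ.+ j)) ⟩
  ∏[ 0 , N-1 ℕ.+ N ⟩ t * ∏[ N , M ⟩ (λ j → 1# + X ^ (s ℕ.* (N ℕ.+ j))) ∎
  where
  open SetoidReasoning R.setoid
  t : ℕ → PowerSeries
  t i = 1# - (- (X ^ s)) * (X ^ s) ^ i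
  factor : ∀ i → t i ≈ 1# + X ^ (s ℕ.* suc i)
  factor i = R.trans (1-[-f]*g≈1+f*g (X ^ s) ((X ^ s) ^ i)) (R.+-congˡ {1#} (RE.^-assocʳ X s (suc i)))

qPochhammer-denominator : ∀ s N M → N ℕ.≤ M →
  qPochhammer X (X ^ s) M ≈ qPochhammer X (X ^ s) N * ∏[ N , M ⟩ λ j → 1# - X ^ (s ℕ.* j ℕ.+ 1)
qPochhammer-denominator s N M N≤M = begin
  ∏[ 0 , M ⟩ t                      ≈⟨ ∏-split N M t N≤M ⟩
  ∏[ 0 , N ⟩ t * ∏[ N , M ⟩ t       ≈⟨ R.*-congˡ {∏[ 0 , N ⟩ t} (∏-cong N M factor) ⟩
  ∏[ 0 , N ⟩ t * ∏[ N , M ⟩ (λ j → 1# - X ^ (s ℕ.* j ℕ.+ 1)) ∎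
  where
  open SetoidReasoning R.setoid
  t : ℕ → PowerSeries
  t i = 1# - X * (X ^ s) ^ i
  factor : ∀ i → t i ≈ 1# - X ^ (s ℕ.* i ℕ.+ 1)
  factor i = R.+-congˡ {1#} (R.-‿cong (begin
    X * (X ^ s) ^ i        ≈⟨ R.*-congˡ {X} (RE.^-assocʳ X s i) ⟩
    X ^ suc (s ℕ.* i)      ≡⟨ cong (X ^_) (ℕ.+-comm 1 (s ℕ.* i)) ⟩
    X ^ (s ℕ.* i ℕ.+ 1)    ∎))

extensionFactor : (k N j : ℕ) → PowerSeries
extensionFactor k N j =
  (1# + X ^ ((k ℕ.+ 1) ℕ.* (N ℕ.+ j)))
    / (1# - X ^ ((k ℕ.+ 1) ℕ.* j ℕ.+ 1)) ⟨ 1-X^[n+1]-constantTerm ((k ℕ.+ 1) ℕ.* j) ⟩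

-- By uniqueness of quotients it suffices to multiply the right side by the denominator of `G`. That
-- denominator splits at `N`: one part cancels against `D k N`, the other against the product of
-- quotients, leaving the two parts of the numerator of `G`.
G≈D*∏ : ∀ k N M .{{_ : NonZero k}} .{{_ : NonZero N}} → N ℕ.≤ M →
  G k N M ≈ D k N * ∏[ N , M ⟩ (extensionFactor k N)
G≈D*∏ k N M N≤M = R.sym (/-unique (P M) (A * B M) (D k N * Q) (constantTerm M) (begin
  (D k N * Q) * (A * B M)
    ≈⟨ R.*-congˡ {D k N * Q} (R.*-congˡ {A} (qPochhammer-denominator (k ℕ.+ 1) N M N≤M)) ⟩
  (D k N * Q) * (A * (B N * V))
    ≈⟨ R.*-congˡ {D k N * Q} (R.*-assoc A (B N) V) ⟨
  (D k N * Q) * ((A * B N) * V)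
    ≈⟨ interchange (D k N) Q (A * B N) V ⟩
  (D k N * (A * B N)) * (Q * V)
    ≈⟨ R.*-cong {D k N * (A * B N)} {P N} (/-* (P N) (A * B N) (constantTerm N))
         (∏-/ N M u v λ j → 1-X^[n+1]-constantTerm ((k ℕ.+ 1) ℕ.* j)) ⟩
  P N * U
    ≈⟨ qPochhammer-numerator (k ℕ.+ 1) N M N≤M ⟨
  P M ∎))
  where
  open SetoidReasoning R.setoid
  open CommutativeSemigroupProperties R.*-commutativeSemigroup using (interchange)
  P B u v : ℕ → PowerSeries
  P L = qPochhammer (- (X ^ (k ℕ.+ 1))) (X ^ (k ℕ.+ 1)) (N ℕ.+ L ℕ.∸ 1)
  B L = qPochhammer X (X ^ (k ℕ.+ 1)) L
  u j = 1# + X ^ ((k ℕ.+ 1) ℕ.* (N ℕ.+ j))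
  v j = 1# - X ^ ((k ℕ.+ 1) ℕ.* j ℕ.+ 1)
  A Q U V : PowerSeries
  A = qPochhammer (- (X ^ k)) (X ^ (k ℕ.+ 1)) N
  Q = ∏[ N , M ⟩ (extensionFactor k N)
  U = ∏[ N , M ⟩ u
  V = ∏[ N , M ⟩ v
  constantTerm : ∀ L → (A * B L) 0 ≡ 1ℤ
  constantTerm L = denominator-constantTerm (X ^ k) X (X ^ (k ℕ.+ 1)) N L (^-constantTerm k) refl

-- Substitution of a power of x

-- substituteX^ b c f is the series x^c f(x^(b+1)).  The extra parameter c turns the
-- definition into a structural recursion on the coefficient index.
substituteX^ : ℕ → ℕ → PowerSeries → PowerSeries
substituteX^ b zero    f zero    = f 0
substituteX^ b zero    f (suc n) = substituteX^ b b (tail f) n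
substituteX^ b (suc c) f zero    = 0ℤ
substituteX^ b (suc c) f (suc n) = substituteX^ b c f n

substituteX^-cong : ∀ b c {f g : PowerSeries} → f ≈ g → substituteX^ b c f ≈ substituteX^ b c g
substituteX^-cong b zero    f≈g zero    = f≈g 0
substituteX^-cong b zero    f≈g (suc n) = substituteX^-cong b b (f≈g ∘ suc) n
substituteX^-cong b (suc c) f≈g zero    = refl
substituteX^-cong b (suc c) f≈g (suc n) = substituteX^-cong b c f≈g n

substituteX^-+ : ∀ b c f g → substituteX^ b c (f + g) ≈ substituteX^ b c f + substituteX^ b c g
substituteX^-+ b zero    f g zero    = refl
substituteX^-+ b zero    f g (suc n) = substituteX^-+ b b (tail f) (tail g) n
substituteX^-+ b (suc c) f g zero    = refl
substituteX^-+ b (suc c) f g (suc n) = substituteX^-+ b c f g n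

substituteX^-neg : ∀ b c f → substituteX^ b c (- f) ≈ - substituteX^ b c f
substituteX^-neg b zero    f zero    = refl
substituteX^-neg b zero    f (suc n) = substituteX^-neg b b (tail f) n
substituteX^-neg b (suc c) f zero    = refl
substituteX^-neg b (suc c) f (suc n) = substituteX^-neg b c f n

substituteX^-∙ : ∀ b c k f → substituteX^ b c (k ∙ f) ≈ k ∙ substituteX^ b c f
substituteX^-∙ b zero    k f zero    = refl
substituteX^-∙ b zero    k f (suc n) = substituteX^-∙ b b k (tail f) n
substituteX^-∙ b (suc c) k f zero    = sym (ℤ.*-zeroʳ k)
substituteX^-∙ b (suc c) k f (suc n) = substituteX^-∙ b c k f n

substituteX^-0# : ∀ b c → substituteX^ b c 0# ≈ 0#
substituteX^-0# b zero    zero    = refl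
substituteX^-0# b zero    (suc n) = substituteX^-0# b b n
substituteX^-0# b (suc c) zero    = refl
substituteX^-0# b (suc c) (suc n) = substituteX^-0# b c n

tail-X : tail X ≈ 1#
tail-X zero    = refl
tail-X (suc n) = refl

X*-suc : ∀ f n → (X * f) (suc n) ≡ f n
X*-suc f n = begin
  (X * f) (suc n)   ≡⟨ *-tail X f n refl ⟩
  (tail X * f) n    ≡⟨ *-cong {tail X} {1#} {f} tail-X (λ _ → refl) n ⟩
  (1# * f) n        ≡⟨ *-identityˡ f n ⟩
  f n               ∎
  where open ≡-Reasoning

substituteX^-1# : ∀ b c → substituteX^ b c 1# ≈ X ^ c
substituteX^-1# b zero    zero    = refl
substituteX^-1# b zero    (suc n) = substituteX^-0# b b n
substituteX^-1# b (suc c) zero    = sym (*-constantTerm X (X ^ c))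
substituteX^-1# b (suc c) (suc n) = trans (substituteX^-1# b c n) (sym (X*-suc (X ^ c) n))

substituteX^-X : ∀ b → substituteX^ b 0 X ≈ X ^ suc b
substituteX^-X b zero    = sym (*-constantTerm X (X ^ b))
substituteX^-X b (suc n) = begin
  substituteX^ b b (tail X) n   ≡⟨ substituteX^-cong b b tail-X n ⟩
  substituteX^ b b 1# n         ≡⟨ substituteX^-1# b b n ⟩
  (X ^ b) n                     ≡⟨ X*-suc (X ^ b) n ⟨
  (X ^ suc b) (suc n)           ∎
  where open ≡-Reasoning

-- Only the left factor carries the shift `x^c`, since it must occur once in the product. A general
-- `c` is needed because passing the head of `f` resets the shift to `b`.
substituteX^-* : ∀ b c f g → substituteX^ b c (f * g) ≈ substituteX^ b c f * substituteX^ b 0 g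
substituteX^-* b zero    f g zero    = refl
substituteX^-* b (suc c) f g zero    = sym (*-constantTerm (substituteX^ b (suc c) f) (substituteX^ b 0 g))
substituteX^-* b (suc c) f g (suc n) = trans
  (substituteX^-* b c f g n)
  (sym (*-tail (substituteX^ b (suc c) f) (substituteX^ b 0 g) n refl))
substituteX^-* b zero    f g (suc n) = begin
  substituteX^ b b (f 0 ∙ tail g + tail f * g) n
    ≡⟨ substituteX^-+ b b (f 0 ∙ tail g) (tail f * g) n ⟩
  substituteX^ b b (f 0 ∙ tail g) n ℤ.+ substituteX^ b b (tail f * g) n
    ≡⟨ cong₂ ℤ._+_ (substituteX^-∙ b b (f 0) (tail g) n) (substituteX^-* b b (tail f) g n) ⟩
  f 0 ℤ.* substituteX^ b b (tail g) n ℤ.+ (substituteX^ b b (tail f) * substituteX^ b 0 g) n ∎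
  where open ≡-Reasoning

substituteX^-^ : ∀ b f n → substituteX^ b 0 (f ^ n) ≈ substituteX^ b 0 f ^ n
substituteX^-^ b f zero    = substituteX^-1# b 0
substituteX^-^ b f (suc n) = R.trans
  (substituteX^-* b 0 f (f ^ n))
  (R.*-congˡ {substituteX^ b 0 f} (substituteX^-^ b f n))

substituteX^-X^ : ∀ b n → substituteX^ b 0 (X ^ n) ≈ X ^ (n ℕ.* suc b)
substituteX^-X^ b n = begin
  substituteX^ b 0 (X ^ n)   ≈⟨ substituteX^-^ b X n ⟩
  substituteX^ b 0 X ^ n     ≈⟨ RE.^-congˡ n (substituteX^-X b) ⟩
  (X ^ suc b) ^ n            ≈⟨ RE.^-assocʳ X (suc b) n ⟩
  X ^ (suc b ℕ.* n)          ≡⟨ cong (X ^_) (ℕ.*-comm (suc b) n) ⟩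
  X ^ (n ℕ.* suc b)          ∎
  where open SetoidReasoning R.setoid

substituteX^-product : ∀ b {n} (t : Fin n → PowerSeries) →
  substituteX^ b 0 (product t) ≈ product λ i → substituteX^ b 0 (t i)
substituteX^-product b {zero}  t = substituteX^-1# b 0
substituteX^-product b {suc n} t = R.trans
  (substituteX^-* b 0 (t zero) (product (t ∘ suc)))
  (R.*-congˡ {substituteX^ b 0 (t zero)} (substituteX^-product b (t ∘ suc)))

qPochhammer-cong : ∀ {z w p q : PowerSeries} n → z ≈ w → p ≈ q → qPochhammer z p n ≈ qPochhammer w q n
qPochhammer-cong n z≈w p≈q = ∏-cong 0 n λ i →
  R.+-congˡ {1#} (R.-‿cong (R.*-cong z≈w (RE.^-congˡ i p≈q)))

substituteX^-qPochhammer : ∀ b z q n →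
  substituteX^ b 0 (qPochhammer z q n) ≈ qPochhammer (substituteX^ b 0 z) (substituteX^ b 0 q) n
substituteX^-qPochhammer b z q n = R.trans
  (substituteX^-product b {n} λ i → 1# - z * q ^ toℕ i)
  (∏-cong 0 n λ i → begin
    φ (1# - z * q ^ i)         ≈⟨ substituteX^-+ b 0 1# (- (z * q ^ i)) ⟩
    φ 1# + φ (- (z * q ^ i))   ≈⟨ R.+-cong (substituteX^-1# b 0) (substituteX^-neg b 0 (z * q ^ i)) ⟩
    1# - φ (z * q ^ i)         ≈⟨ R.+-congˡ {1#} (R.-‿cong (substituteX^-* b 0 z (q ^ i))) ⟩
    1# - φ z * φ (q ^ i)       ≈⟨ R.+-congˡ {1#} (R.-‿cong (R.*-congˡ {φ z} (substituteX^-^ b q i))) ⟩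
    1# - φ z * φ q ^ i         ∎)
  where
  open SetoidReasoning R.setoid
  φ : PowerSeries → PowerSeries
  φ = substituteX^ b 0

substituteX^-/ : ∀ b f g .(g₀≡1 : g 0 ≡ 1ℤ) →
  substituteX^ b 0 (f / g ⟨ g₀≡1 ⟩) ≈ substituteX^ b 0 f / substituteX^ b 0 g ⟨ g₀≡1 ⟩
-- The proof `g₀≡1` serves for the image of `g` as well, since the substitution keeps the constant
-- term definitionally.
substituteX^-/ b f g g₀≡1 = /-unique (φ f) (φ g) (φ (f / g ⟨ g₀≡1 ⟩)) g₀≡1 (R.trans
  (R.sym (substituteX^-* b 0 (f / g ⟨ g₀≡1 ⟩) g))
  (substituteX^-cong b 0 (/-* f g g₀≡1)))
  where
  φ : PowerSeries → PowerSeries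
  φ = substituteX^ b 0

-- The substitution acts on the base and the argument of each q-Pochhammer symbol separately. The
-- bases match because `(k + 1) * suc b` equals `k * suc b + suc b`.
g≈substituteX^-G : ∀ k b N M .{{_ : NonZero k}} .{{_ : NonZero (k ℕ.* suc b)}} →
  g (k ℕ.* suc b) (suc b) (k ℕ.* suc b ℕ.+ suc b) N M ≈ substituteX^ b 0 (G k N M)
g≈substituteX^-G k b N M = R.sym (R.trans
  (substituteX^-/ b (P m) (A k m * B X m) G₀≡1)
  (/-cong (φ (P m)) (P m′) (φ (A k m * B X m)) (A a m′ * B (X ^ suc b) m′) G₀≡1 g₀≡1
    (R.trans (substituteX^-qPochhammer b (- (X ^ m)) (X ^ m) L) (qPochhammer-cong L (φ-neg m φX^m) φX^m))
    (R.trans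
      (substituteX^-* b 0 (A k m) (B X m))
      (R.*-cong {φ (A k m)} {A a m′}
        (R.trans (substituteX^-qPochhammer b (- (X ^ k)) (X ^ m) N)
          (qPochhammer-cong N (φ-neg k (substituteX^-X^ b k)) φX^m))
        (R.trans (substituteX^-qPochhammer b X (X ^ m) M)
          (qPochhammer-cong M (substituteX^-X b) φX^m))))))
  where
  a m m′ L : ℕ
  a  = k ℕ.* suc b
  m  = k ℕ.+ 1
  m′ = a ℕ.+ suc b
  L  = N ℕ.+ M ℕ.∸ 1
  φ : PowerSeries → PowerSeries
  φ = substituteX^ b 0
  P : ℕ → PowerSeries
  P m = qPochhammer (- (X ^ m)) (X ^ m) L
  A : ℕ → ℕ → PowerSeries
  A k m = qPochhammer (- (X ^ k)) (X ^ m) N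
  B : PowerSeries → ℕ → PowerSeries
  B z m = qPochhammer z (X ^ m) M
  G₀≡1 : (A k m * B X m) 0 ≡ 1ℤ
  G₀≡1 = denominator-constantTerm (X ^ k) X (X ^ m) N M (^-constantTerm k) refl
  g₀≡1 : (A a m′ * B (X ^ suc b) m′) 0 ≡ 1ℤ
  g₀≡1 = denominator-constantTerm (X ^ a) (X ^ suc b) (X ^ m′) N M (^-constantTerm a) (^-constantTerm (suc b))
  φX^m : φ (X ^ m) ≈ X ^ m′
  φX^m = R.trans (substituteX^-X^ b m) (R.reflexive (cong (X ^_) (trans
    (ℕ.*-distribʳ-+ (suc b) k 1)
    (cong (a ℕ.+_) (ℕ.*-identityˡ (suc b))))))
  φ-neg : ∀ n {f} → φ (X ^ n) ≈ f → φ (- (X ^ n)) ≈ - f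
  φ-neg n eq = R.trans (substituteX^-neg b 0 (X ^ n)) (R.-‿cong eq)

-- For `b = 1` the two sides differ only in `X ^ 1`, which unfolds to `X * 1#`, so no substitution
-- is involved.
g-1≈G : ∀ k N M .{{_ : NonZero k}} → g k 1 (k ℕ.+ 1) N M ≈ G k N M
g-1≈G k N M = /-cong P P (A * B (X ^ 1)) (A * B X)
  (denominator-constantTerm (X ^ k) (X ^ 1) q N M (^-constantTerm k) (^-constantTerm 1))
  (denominator-constantTerm (X ^ k) X q N M (^-constantTerm k) refl)
  (λ _ → refl)
  (R.*-congˡ {A} (qPochhammer-cong M (R.*-identityʳ X) (λ _ → refl)))
  where
  q P A : PowerSeries
  q = X ^ (k ℕ.+ 1)
  P = qPochhammer (- q) q (N ℕ.+ M ℕ.∸ 1)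
  A = qPochhammer (- (X ^ k)) q N
  B : PowerSeries → PowerSeries
  B z = qPochhammer z q M

-- Non-negativity

nonNegative-cong : ∀ {f g} → f ≈ g → NonNegative f → NonNegative g
nonNegative-cong f≈g f≥0 n = subst (ℤ._≤_ 0ℤ) (f≈g n) (f≥0 n)

*-nonNegativeℤ : ∀ {i j} → 0ℤ ℤ.≤ i → 0ℤ ℤ.≤ j → 0ℤ ℤ.≤ i ℤ.* j
*-nonNegativeℤ {i} {j} i≥0 j≥0 =
  subst (ℤ._≤ i ℤ.* j) (ℤ.*-zeroʳ i) (ℤ.*-monoˡ-≤-nonNeg i {{ℤ.nonNegative i≥0}} j≥0)

∑-nonNegative : ∀ {n} (t : Fin n → ℤ) → (∀ i → 0ℤ ℤ.≤ t i) → 0ℤ ℤ.≤ ∑ t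
∑-nonNegative {zero}  t t≥0 = ℤ.≤-refl
∑-nonNegative {suc n} t t≥0 = ℤ.+-mono-≤ (t≥0 zero) (∑-nonNegative (t ∘ suc) (t≥0 ∘ suc))

+-nonNegative : ∀ {f g} → NonNegative f → NonNegative g → NonNegative (f + g)
+-nonNegative f≥0 g≥0 n = ℤ.+-mono-≤ (f≥0 n) (g≥0 n)

*-nonNegative : ∀ {f g} → NonNegative f → NonNegative g → NonNegative (f * g)
*-nonNegative {f} {g} f≥0 g≥0 n =
  ∑-nonNegative {suc n} (λ i → f (toℕ i) ℤ.* g (n ℕ.∸ toℕ i)) λ i →
    *-nonNegativeℤ (f≥0 (toℕ i)) (g≥0 (n ℕ.∸ toℕ i))

1#-nonNegative : NonNegative 1#
1#-nonNegative zero    = ℤ.+≤+ ℕ.z≤n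
1#-nonNegative (suc n) = ℤ.≤-refl

X-nonNegative : NonNegative X
X-nonNegative 0             = ℤ.≤-refl
X-nonNegative 1             = ℤ.+≤+ ℕ.z≤n
X-nonNegative (suc (suc n)) = ℤ.≤-refl

product-nonNegative : ∀ {n} (t : Fin n → PowerSeries) → (∀ i → NonNegative (t i)) → NonNegative (product t)
product-nonNegative {zero}  t t≥0 = 1#-nonNegative
product-nonNegative {suc n} t t≥0 =
  *-nonNegative {t zero} (t≥0 zero) (product-nonNegative (t ∘ suc) (t≥0 ∘ suc))

^-nonNegative : ∀ f n → NonNegative f → NonNegative (f ^ n)
^-nonNegative f zero    f≥0 = 1#-nonNegative
^-nonNegative f (suc n) f≥0 = *-nonNegative {f} f≥0 (^-nonNegative f n f≥0)

-- The reciprocal of `1# - g` is a sum of powers of `1# - (1# - g)`, that is, of `g`.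
/[1-g]-nonNegative : ∀ f g .(p : (1# - g) 0 ≡ 1ℤ) →
  NonNegative f → NonNegative g → NonNegative (f / (1# - g) ⟨ p ⟩)
/[1-g]-nonNegative f g p f≥0 g≥0 = *-nonNegative {f} {reciprocal (1# - g)} f≥0 λ n →
  ∑-nonNegative {suc n} (λ k → ((1# - (1# - g)) ^ toℕ k) n) λ k →
    ^-nonNegative (1# - (1# - g)) (toℕ k) (nonNegative-cong (R.sym (1-[1-f]≈f g)) g≥0) n

substituteX^-nonNegative : ∀ b c {f} → NonNegative f → NonNegative (substituteX^ b c f)
substituteX^-nonNegative b zero    f≥0 zero    = f≥0 0
substituteX^-nonNegative b zero    f≥0 (suc n) = substituteX^-nonNegative b b (f≥0 ∘ suc) n
substituteX^-nonNegative b (suc c) f≥0 zero    = ℤ.≤-refl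
substituteX^-nonNegative b (suc c) f≥0 (suc n) = substituteX^-nonNegative b c f≥0 n

extensionFactor-nonNegative : ∀ k N j → NonNegative (extensionFactor k N j)
extensionFactor-nonNegative k N j = /[1-g]-nonNegative (1# + X ^ e) (X ^ (d ℕ.+ 1)) (1-X^[n+1]-constantTerm d)
  (+-nonNegative {1#} 1#-nonNegative (^-nonNegative X e X-nonNegative))
  (^-nonNegative X (d ℕ.+ 1) X-nonNegative)
  where
  d e : ℕ
  d = (k ℕ.+ 1) ℕ.* j
  e = (k ℕ.+ 1) ℕ.* (N ℕ.+ j)

G-nonNegative : ∀ k N M .{{_ : NonZero k}} .{{_ : NonZero N}} → N ℕ.≤ M → NonNegative (D k N) → NonNegative (G k N M)
G-nonNegative k N M N≤M D≥0 = nonNegative-cong (R.sym (G≈D*∏ k N M N≤M))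
  (*-nonNegative {D k N} D≥0
    (product-nonNegative {M ℕ.∸ N} (λ i → extensionFactor k N (N ℕ.+ toℕ i)) λ i →
      extensionFactor-nonNegative k N (N ℕ.+ toℕ i)))

theorem1p3 : (∀ (k N M : ℕ) .{{_ : NonZero k}} .{{_ : NonZero N}} .{{_ : NonZero M}} → N ℕ.≤ M →
    G k N M ≈ D k N * ∏[ N , M ⟩ (λ j →
    (1# + X ^ ((k ℕ.+ 1) ℕ.* (N ℕ.+ j)))
    / (1# - X ^ ((k ℕ.+ 1) ℕ.* j ℕ.+ 1)) ⟨ 1-X^[n+1]-constantTerm ((k ℕ.+ 1) ℕ.* j) ⟩))
    ×
    ((∀ (a b m N M : ℕ) .{{_ : NonZero a}} .{{_ : NonZero b}} .{{_ : NonZero m}} .{{_ : NonZero N}} .{{_ : NonZero M}} →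
    b ∣ a → a ℕ.+ b ≡ m → N ℕ.≤ M → NonNegative (g a b m N M))
    ⇔
    (∀ (k N : ℕ) .{{_ : NonZero k}} .{{_ : NonZero N}} → NonNegative (D k N)))
theorem1p3 = (λ k N M → G≈D*∏ k N M) , mk⇔ g≥0⇒D≥0 D≥0⇒g≥0
  where
  g≥0⇒D≥0 : (∀ (a b m N M : ℕ) .{{_ : NonZero a}} .{{_ : NonZero b}} .{{_ : NonZero m}} .{{_ : NonZero N}} .{{_ : NonZero M}} →
    b ∣ a → a ℕ.+ b ≡ m → N ℕ.≤ M → NonNegative (g a b m N M)) →
    ∀ (k N : ℕ) .{{_ : NonZero k}} .{{_ : NonZero N}} → NonNegative (D k N)
  -- `D k N` is the instance `a = k`, `b = 1`, `m = k + 1`, `M = N`.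
  g≥0⇒D≥0 g≥0 k N = nonNegative-cong (g-1≈G k N N)
    (g≥0 k 1 (k ℕ.+ 1) N N (divides k (sym (ℕ.*-identityʳ k))) refl ℕ.≤-refl)
    where
    instance
      k+1≢0 : NonZero (k ℕ.+ 1)
      k+1≢0 = ℕ.>-nonZero (ℕ.m≤n+m 1 k)
  D≥0⇒g≥0 : (∀ (k N : ℕ) .{{_ : NonZero k}} .{{_ : NonZero N}} → NonNegative (D k N)) →
    ∀ (a b m N M : ℕ) .{{_ : NonZero a}} .{{_ : NonZero b}} .{{_ : NonZero m}} .{{_ : NonZero N}} .{{_ : NonZero M}} →
    b ∣ a → a ℕ.+ b ≡ m → N ℕ.≤ M → NonNegative (g a b m N M)
  -- Divisibility supplies `k` with `a = k * b`; writing `b` as a successor fits the convention that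
  -- `substituteX^ b-1 0` is `x ↦ x^b`.
  D≥0⇒g≥0 D≥0 a b@(suc b-1) m N M (divides k refl) refl N≤M =
    nonNegative-cong (R.sym (g≈substituteX^-G k b-1 N M {{k≢0}}))
      (substituteX^-nonNegative b-1 0 (G-nonNegative k N M {{k≢0}} N≤M (D≥0 k N {{k≢0}})))
    where
    -- A vanishing `k` would make `a = k * b` vanish.
    .k≢0 : NonZero k
    k≢0 = ℕ.m*n≢0⇒m≢0 k
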